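{- Let $k\ge1$ be an integer and let $H=(V,E)$ be a $(k+1)$-uniform hypergraph. (i) If $k$ is odd, then $$T_{\mathrm{HG}}(H;x+1,y+1)=\sum_{A\subseteq E}T_{\mathrm{HG}}(H|_A;0,y+1)\,T_{\mathrm{HG}}(H/A;x+1,0).$$ (ii) If $k$ is even, then both $$T_{\mathrm{HG}}(H;x+1,y+1)=\sum_{A\subseteq E}(-1)^{v(H)-\kappa_H(A)}\,\chi^*(H|_A;-y)\,T_{\mathrm{HG}}(H/A;x+1,0)$$ and $$T_{\mathrm{HG}}(H;x+1,y+1)=\sum_{A\subseteq E}(-1)^{v(H/A)-\kappa(H/A)}\,T_{\mathrm{HG}}(H|_A;0,y+1)\,\chi(H/A;-x).$$
   Context: A hypergraph is a pair $H=(V,E)$ where $V$ is a finite set and $E$ is a finite multiset (parallel hyperedges are allowed and treated as distinct elements of $E$) of multisets of elements of $V$, called hyperedges. For $e\in E$, $d(e)$ is the size of $e$ counted with multiplicity; it is always assumed that $d(e)>1$. $H$ is $(k+1)$-uniform if $d(e)=k+1$ for all $e\in E$. Write $v(H)=|V|$. $\kappa(H)$ is the number of connected components of the bipartite incidence graph with vertex classes $V$ and $E$, in which $u\in V$ and $e\in E$ are joined by as many edges as the multiplicity of $u$ in $e$. For $A\subseteq E$ let $H|_A=(V,A)$, $\kappa(A)=\kappa_H(A)=\kappa(H|_A)$, $d(A)=\sum_{e\in A}d(e)$, and $|A|$ is the number of hyperedges in $A$. Hypergraph Tutte polynomial: $T_{\mathrm{HG}}(H;x,y)=\sum_{A\subseteq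 E}(x-1)^{\kappa(A)-\kappa(H)}(y-1)^{d(A)-|A|-v(H)+\kappa(A)}$. Contraction of a hyperedge: $H/e=(V',E')$ with $V'=(V\setminus e)\cup\{v_e\}$ (all vertices occurring in $e$ are removed and one new vertex $v_e$ is added) and $E'=\{f':f\in E\setminus\{e\}\}$, where $f'$ is obtained from $f$ by replacing every occurrence (with multiplicity) of a vertex of $e$ by $v_e$. For $A\subseteq E$, $H/A$ is the hypergraph (well defined up to isomorphism) obtained by successively contracting the hyperedges of $A$. For a $(k+1)$-uniform hypergraph $H=(V,E)$: $\chi(H;x)=\sum_{B\subseteq E}(-1)^{|B|}x^{\kappa(B)-\kappa(H)}$ and $\chi^*(H;x)=\sum_{B\subseteq E}(-1)^{|B|}x^{k(|E|-|B|)-v(H)+\kappa(E\setminus B)}$. -}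

module Defs where

open import Algebra.Bundles using (CommutativeRing)
import Algebra.Properties.Semiring.Exp as SemiringExp
open import Data.Fin.Base using (Fin; zero; suc; punchIn)
import Data.Fin.Properties as Fin
open import Data.Fin.Subset using (Subset; inside; outside; ∣_∣; ∁)
open import Data.Fin.Subset.Properties using (nonempty?)
open import Data.List.Base
  using (List; []; _∷_; _++_; length; map; filter; concatMap; deduplicate; allFin; tabulate)
open import Data.List.Membership.Propositional using (_∈_)
open import Data.List.Membership.Propositional.Properties using (∈-filter⁺; ∈-allFin)
import Data.List.Membership.DecPropositional as DecMembership
open import Data.List.Properties using (length-map)
open import Data.List.Relation.Unary.Any using (here; there; index)
open import Data.Nat.Base using (ℕ; zero; suc; _+_; _*_; _∸_; _<_)
open import Data.Nat.ListAction using (sum)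
open import Data.Product.Base using (∃; _×_; _,_; proj₁; proj₂)
open import Data.Sum.Base using (_⊎_; inj₁; inj₂)
open import Data.Sum.Properties using (≡-dec)
open import Data.Vec.Base using ([]; _∷_; removeAt)
open import Function.Base using (_∘_)
open import Relation.Binary.Construct.Closure.Equivalence as Eq using (EqClosure)
open import Relation.Binary.Construct.Closure.ReflexiveTransitive using (ε; _◅_)
open import Relation.Binary.Construct.Closure.Symmetric using (fwd; bwd)
open import Relation.Binary.Definitions using (Decidable; DecidableEquality)
open import Relation.Binary.PropositionalEquality using (_≡_; refl; sym; subst)
open import Relation.Nullary.Decidable using (yes; no; map′; _×-dec_; _⊎-dec_)

-- A multigraph on a set X is given by its list of edges.
module Multigraph {X : Set} (_≟_ : DecidableEquality X) where

  Connected : List (X × X) → X → X → Set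
  Connected es = EqClosure (λ x y → (x , y) ∈ es)

  private
    module _ {a b : X} {es : List (X × X)} where

      Via : X → X → Set
      Via x y = Connected es x y
              ⊎ (Connected es x a × Connected es b y)
              ⊎ (Connected es x b × Connected es a y)

      symm : ∀ {x y} → Connected es x y → Connected es y x
      symm = Eq.symmetric _

      trns : ∀ {x y z} → Connected es x y → Connected es y z → Connected es x z
      trns = Eq.transitive _

      weaken : ∀ {x y} → Connected es x y → Connected ((a , b) ∷ es) x y
      weaken = Eq.map there

      from-via : ∀ {x y} → Via x y → Connected ((a , b) ∷ es) x y
      from-via (inj₁ p)              = weaken p
      from-via (inj₂ (inj₁ (p , q))) =
        Eq.transitive _ (weaken p) (fwd (here refl) ◅ weaken q)
      from-via (inj₂ (inj₂ (p , q))) =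
        Eq.transitive _ (weaken p) (bwd (here refl) ◅ weaken q)

      step : ∀ {x y z} → Connected es x y → Via y z → Via x z
      step p (inj₁ q)              = inj₁ (trns p q)
      step p (inj₂ (inj₁ (q , r))) = inj₂ (inj₁ (trns p q , r))
      step p (inj₂ (inj₂ (q , r))) = inj₂ (inj₂ (trns p q , r))

      ab : ∀ {z} → Via b z → Via a z
      ab (inj₁ q)              = inj₂ (inj₁ (ε , q))
      ab (inj₂ (inj₁ (q , r))) = inj₂ (inj₁ (ε , r))
      ab (inj₂ (inj₂ (q , r))) = inj₁ r

      ba : ∀ {z} → Via a z → Via b z
      ba (inj₁ q)              = inj₂ (inj₂ (ε , q))
      ba (inj₂ (inj₁ (q , r))) = inj₁ r
      ba (inj₂ (inj₂ (q , r))) = inj₂ (inj₂ (ε , r))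

      to-via : ∀ {x y} → Connected ((a , b) ∷ es) x y → Via x y
      to-via ε                      = inj₁ ε
      to-via (fwd (here refl) ◅ ps) = ab (to-via ps)
      to-via (bwd (here refl) ◅ ps) = ba (to-via ps)
      to-via (fwd (there i) ◅ ps)   = step (fwd i ◅ ε) (to-via ps)
      to-via (bwd (there i) ◅ ps)   = step (bwd i ◅ ε) (to-via ps)

    no-edges : ∀ {x y} → Connected [] x y → x ≡ y
    no-edges ε            = refl
    no-edges (fwd () ◅ _)
    no-edges (bwd () ◅ _)

  connected? : ∀ es → Decidable (Connected es)
  connected? []             x y = map′ (λ { refl → ε }) no-edges (x ≟ y)
  connected? ((a , b) ∷ es) x y = map′ from-via to-via
    (connected? es x y
      ⊎-dec (connected? es x a ×-dec connected? es b y)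
      ⊎-dec (connected? es x b ×-dec connected? es a y))

  components : List X → List (X × X) → ℕ
  components xs es = length (deduplicate (connected? es) xs)

-- A hypergraph with vertex set Fin v and m hyperedges.  Hyperedges are indexed
-- by Fin m, so that parallel ones stay distinct; each is a multiset of vertices,
-- represented by a list whose order is never used.
record Hypergraph (m : ℕ) : Set where
  field
    v      : ℕ
    edge   : Fin m → List (Fin v)
    size>1 : ∀ e → 1 < length (edge e)

  d : Fin m → ℕ
  d e = length (edge e)

open Hypergraph public using (v; edge; size>1; d)

Uniform : ℕ → ∀ {m} → Hypergraph m → Set
Uniform r H = ∀ e → d H e ≡ r

elements : ∀ {m} (A : Subset m) → Fin ∣ A ∣ → Fin m
elements (outside ∷ A) i       = suc (elements A i)
elements (inside  ∷ A) zero    = zero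
elements (inside  ∷ A) (suc i) = suc (elements A i)

infixl 8 _↾_ _/_

-- H ↾ A is the hypergraph (V , A).
_↾_ : ∀ {m} → Hypergraph m → (A : Subset m) → Hypergraph ∣ A ∣
H ↾ A = record
  { v      = v H
  ; edge   = edge H ∘ elements A
  ; size>1 = size>1 H ∘ elements A
  }

dˢ : ∀ {m} → Hypergraph m → Subset m → ℕ
dˢ H A = sum (tabulate (d H ∘ elements A))

-- One entry per occurrence of u in e, so multiplicities are kept.
incidences : ∀ {m} (H : Hypergraph m) → List ((Fin (v H) ⊎ Fin m) × (Fin (v H) ⊎ Fin m))
incidences {m} H = concatMap (λ e → map (λ u → inj₁ u , inj₂ e) (edge H e)) (allFin m)

κ : ∀ {m} → Hypergraph m → ℕ
κ {m} H = Multigraph.components (≡-dec Fin._≟_ Fin._≟_)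
            (map inj₁ (allFin (v H)) ++ map inj₂ (allFin m)) (incidences H)

-- Contracting a hyperedge f: the new vertex set {v_f} ∪ (V ∖ f) is numbered with
-- v_f as zero, followed by the vertices outside f.
module _ {n : ℕ} (f : List (Fin n)) where
  open DecMembership (Fin._≟_ {n}) using (_∈?_; _∉?_)

  untouched : List (Fin n)
  untouched = filter (_∉? f) (allFin n)

  collapse : Fin n → Fin (suc (length untouched))
  collapse u with u ∈? f
  ... | yes _  = zero
  ... | no u∉f = suc (index (∈-filter⁺ (_∉? f) (∈-allFin u) u∉f))

contract : ∀ {m} → Hypergraph (suc m) → Fin (suc m) → Hypergraph m
contract H e = record
  { v      = suc (length (untouched (edge H e)))
  ; edge   = λ i → map (collapse (edge H e)) (edge H (punchIn e i))
  ; size>1 = λ i → subst (1 <_) (sym (length-map _ (edge H (punchIn e i))))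
                         (size>1 H (punchIn e i))
  }

-- After contracting e, removeAt A e is the set of hyperedges of A still to be
-- contracted, in the numbering of the hyperedges of contract H e.  The order of
-- contraction matters only up to isomorphism; this fixes one.
contractAll : ∀ {m} → Hypergraph m → Subset m → ∃ Hypergraph
contractAll {zero}  H A = zero , H
contractAll {suc m} H A with nonempty? A
... | yes (e , _) = contractAll (contract H e) (removeAt A e)
... | no  _       = suc m , H

_/_ : ∀ {m} (H : Hypergraph m) (A : Subset m) → Hypergraph (proj₁ (contractAll H A))
H / A = proj₂ (contractAll H A)

-- The integer polynomials evaluated in a commutative ring R; taking R to be a
-- polynomial ring over ℤ and the arguments to be its variables gives the
-- polynomials themselves.  The truncated subtractions in exponents never
-- truncate: κ can only grow when hyperedges are removed, |A| ≤ d(A), and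
-- d(A) - |A| - v(H) + κ(A) is the cycle rank of the incidence graph of (V , A).
-- Here 0# ^ 0 is 1#.
module Polynomials {c ℓ} (R : CommutativeRing c ℓ) where
  open CommutativeRing R
    using (Carrier; _-_; -_; 0#; 1#; semiring)
    renaming (_+_ to _⊕_; _*_ to _⊗_)
  open SemiringExp semiring using (_^_) public

  ∑⊆ : ∀ {m} → (Subset m → Carrier) → Carrier
  ∑⊆ {zero}  f = f []
  ∑⊆ {suc m} f = ∑⊆ (f ∘ (outside ∷_)) ⊕ ∑⊆ (f ∘ (inside ∷_))

  T : ∀ {m} → Hypergraph m → Carrier → Carrier → Carrier
  T H x y = ∑⊆ λ A →
    ((x - 1#) ^ (κ (H ↾ A) ∸ κ H)) ⊗
    ((y - 1#) ^ (((dˢ H A ∸ ∣ A ∣) + κ (H ↾ A)) ∸ v H))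

  χ : ∀ {m} → Hypergraph m → Carrier → Carrier
  χ H x = ∑⊆ λ B → ((- 1#) ^ ∣ B ∣) ⊗ (x ^ (κ (H ↾ B) ∸ κ H))

  -- For (k+1)-uniform hypergraphs.
  χ* : ∀ (k : ℕ) {m} → Hypergraph m → Carrier → Carrier
  χ* k {m} H x = ∑⊆ λ B →
    ((- 1#) ^ ∣ B ∣) ⊗ (x ^ ((k * (m ∸ ∣ B ∣) + κ (H ↾ ∁ B)) ∸ v H))

{-# OPTIONS --safe #-}

-- Write c(A) = κ(H ↾ A).  Contracting A merges exactly the components of (V , A),
-- so v(H / A) = c(A) and κ((H / A) ↾ D) = c(A ∪ D).  Hence the A-th product on the
-- right-hand side expands into a sum over C ⊆ A ⊆ B of
--   ± x ^ (c(B) - κ(H)) · y ^ (k|C| - v(H) + c(C)),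
-- and all three sign conventions are chosen so that, for the given parity of k, ±
-- depends on A only through (-1)^|A|.  Summing over the A between C and B leaves the
-- terms with C = B, which make up T H (x + 1) (y + 1).
module Submission where

open import Defs
open import Algebra.Bundles using (CommutativeRing)
import Algebra.Properties.AbelianGroup as AbelianGroupProperties
import Algebra.Properties.CommutativeSemiring.Exp as CommutativeExp
import Algebra.Properties.Ring as RingProperties
import Algebra.Properties.Semiring.Exp as Exp
import Algebra.Solver.Ring.NaturalCoefficients.Default as Solver
open import Data.Fin.Base using (Fin; zero; suc; punchIn; punchOut)
import Data.Fin.Properties as Fin
open import Data.Fin.Subset as Subset using (Subset; inside; outside; ∣_∣; ∁; Nonempty)
open import Data.Fin.Subset.Properties using (nonempty?; Empty-unique; ∣⊥∣≡0; ∣∁p∣≡n∸∣p∣; ∣p∣≤n)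
import Data.List.Membership.DecPropositional as DecMembership
open import Data.Nat.Base as ℕ using (ℕ; zero; suc; _∸_; _≤_; _≥_)
open import Data.Nat.Divisibility using (_∣_; _∤_; divides)
import Data.Nat.Properties as ℕ
open import Data.Product.Base using (∃; _×_; _,_; proj₁; proj₂)
open import Data.Sum.Base using (_⊎_; inj₁; inj₂)
open import Data.Vec.Base as Vec using ([]; _∷_; removeAt; insertAt; here; there)
open import Function.Base using (_∘_; id)
import Relation.Binary.Reasoning.Setoid as SetoidReasoning
open import Relation.Binary.PropositionalEquality as ≡ using (_≡_)
open import Relation.Nullary using (¬_; yes; no; contradiction)

-- The sign `(-1)^|A|` has a different source for each parity of `k`. The nullity exponent of
-- `H / A` contributes `(-1)^(k|D|)` for a set `D` of remaining hyperedges. For odd `k` this is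
-- `(-1)^|D|`, with `|D| = |B| - |A|`. For even `k` it is 1, so one factor has to carry an explicit
-- sign: `χ*` does so in place of the left factor, `χ` in place of the right one, and the prefactors
-- only clear signs that come from `κ` and `v`. The obstacle is that `H / A` arises by iterated
-- contraction, each time with fresh numberings of vertices and hyperedges. Sets of its hyperedges
-- are therefore matched with supersets of `A` only through the two numbers on which the summands
-- depend, component count and size.

module Connectivity where
  open import Data.Empty using (⊥-elim)
  open import Data.List.Base
    using (List; []; _∷_; _++_; length; lookup; map; allFin; deduplicate; tabulate)
  open import Data.List.Membership.Propositional using (_∈_; lose; find)
  open import Data.List.Membership.Propositional.Properties
  open import Data.List.Properties using (length-map; length-++; length-tabulate)
  import Data.List.Relation.Unary.All as All
  open import Data.List.Relation.Unary.AllPairs using (AllPairs; []; _∷_)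
  open import Data.List.Relation.Unary.Any as Any using (Any; here; there; index)
  import Data.List.Relation.Unary.Any.Properties as Any
  open import Data.List.Relation.Unary.Unique.DecSetoid.Properties using (deduplicate-!)
  open import Data.List.Relation.Unary.Unique.Propositional.Properties using (allFin⁺; filter⁺)
  open import Data.Nat.Base using (_+_; _*_)
  open import Data.Nat.ListAction using (sum)
  open import Data.Nat.Properties
  open import Data.Sum.Properties using (≡-dec)
  import Data.Vec.Functional as Func
  open import Data.Vec.Properties
    using (insertAt-lookup; insertAt-punchIn; insertAt-removeAt; []=⇒lookup; lookup⇒[]=)
  open import Relation.Binary.Bundles using (DecSetoid)
  open import Relation.Binary.Construct.Closure.Equivalence as Eq using (EqClosure)
  open import Relation.Binary.Construct.Closure.ReflexiveTransitive using (ε)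
  open import Relation.Binary.Definitions using (Symmetric)
  open import Relation.Binary.PropositionalEquality

  -- Components of the incidence graph, counted by vertices

  module _ {X Y : Set} {_~_ : X → X → Set} (~-sym : Symmetric _~_) where

    lookup-injective : ∀ {xs} → AllPairs (λ x x′ → ¬ x ~ x′) xs →
                       ∀ i j → lookup xs i ~ lookup xs j → i ≡ j
    lookup-injective (_ ∷ _)   zero    zero    _ = refl
    lookup-injective (x≁ ∷ _)  zero    (suc j) p = ⊥-elim (All.lookup x≁ (∈-lookup j) p)
    lookup-injective (x≁ ∷ _)  (suc i) zero    p = ⊥-elim (All.lookup x≁ (∈-lookup i) (~-sym p))
    lookup-injective (_ ∷ xs≁) (suc i) (suc j) p = cong suc (lookup-injective xs≁ i j p)

    -- Pigeonhole principle: a common partner forces `~`, so any choice of partners for pairwise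
    -- unrelated elements has injective indices. `Rel` need not be functional.
    length-≤ : ∀ {xs : List X} {ys : List Y} (Rel : X → Y → Set) →
               AllPairs (λ x x′ → ¬ x ~ x′) xs →
               (∀ {x} → x ∈ xs → Any (Rel x) ys) →
               (∀ {x x′ y} → Rel x y → Rel x′ y → x ~ x′) →
               length xs ≤ length ys
    length-≤ {xs} {ys} Rel xs≁ total coherent = Fin.injective⇒≤ {f = f} λ {i} {j} fi≡fj →
      lookup-injective xs≁ i j (coherent (Any.lookup-index (image i))
        (subst (Rel _ ∘ lookup ys) (sym fi≡fj) (Any.lookup-index (image j))))
      where
      image = λ i → total (∈-lookup {xs = xs} i)
      f : Fin (length xs) → Fin (length ys)
      f i = index (image i)

  module _ {m : ℕ} (H : Hypergraph m) where

    Adjacent : Fin (v H) → Fin (v H) → Set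
    Adjacent u w = ∃ λ e → u ∈ edge H e × w ∈ edge H e

    Joined : Fin (v H) → Fin (v H) → Set
    Joined = EqClosure Adjacent

    Node : Set
    Node = Fin (v H) ⊎ Fin m

    open Multigraph (≡-dec (Fin._≟_ {v H}) (Fin._≟_ {m})) using (Connected; connected?)

    nodes : List Node
    nodes = map inj₁ (allFin (v H)) ++ map inj₂ (allFin m)

    ∈-nodes : ∀ a → a ∈ nodes
    ∈-nodes (inj₁ u) = ∈-++⁺ˡ (∈-map⁺ inj₁ (∈-allFin u))
    ∈-nodes (inj₂ e) = ∈-++⁺ʳ _ (∈-map⁺ inj₂ (∈-allFin e))

    incidence⁺ : ∀ {u e} → u ∈ edge H e → (inj₁ u , inj₂ e) ∈ incidences H
    incidence⁺ {u} {e} u∈e =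
      ∈-concatMap⁺ _ (lose (∈-allFin e) (∈-map⁺ _ u∈e))

    incidence⁻ : ∀ {a b} → (a , b) ∈ incidences H →
                 ∃ λ u → ∃ λ e → u ∈ edge H e × a ≡ inj₁ u × b ≡ inj₂ e
    incidence⁻ ab∈ with find (∈-concatMap⁻ _ {xs = allFin m} ab∈)
    ... | e , _ , ab∈e with ∈-map⁻ _ ab∈e
    ... | u , u∈e , refl = u , e , u∈e , refl , refl

    member : ∀ e → ∃ λ u → u ∈ edge H e
    member e with edge H e | size>1 H e
    ... | u ∷ _ | _ = u , here refl

    -- Hyperedges are nonempty by `size>1`, so every component of the incidence graph contains a
    -- vertex. Moving each node to a vertex of its component reduces all questions about `κ` to
    -- `Joined`.
    vertexOf : Node → Fin (v H)
    vertexOf (inj₁ u) = u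
    vertexOf (inj₂ e) = proj₁ (member e)

    nodeSetoid : DecSetoid _ _
    nodeSetoid = record
      { _≈_ = Connected (incidences H)
      ; isDecEquivalence = record
        { isEquivalence = Eq.isEquivalence _
        ; _≟_ = connected? (incidences H)
        }
      }

    open DecSetoid nodeSetoid using () renaming (sym to ~-sym; trans to ~-trans)

    toVertex : ∀ a → Connected (incidences H) a (inj₁ (vertexOf a))
    toVertex (inj₁ u) = ε
    toVertex (inj₂ e) = ~-sym (Eq.return (incidence⁺ (proj₂ (member e))))

    connected⇒joined : ∀ {a b} → Connected (incidences H) a b → Joined (vertexOf a) (vertexOf b)
    connected⇒joined = Eq.gmap vertexOf adjacent
      where
      adjacent : ∀ {a b} → (a , b) ∈ incidences H → Adjacent (vertexOf a) (vertexOf b)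
      adjacent ab∈ with incidence⁻ ab∈
      ... | u , e , u∈e , refl , refl = e , u∈e , proj₂ (member e)

    joined⇒connected : ∀ {u w} → Joined u w → Connected (incidences H) (inj₁ u) (inj₁ w)
    joined⇒connected = Eq.gfold (Eq.isEquivalence _) inj₁
      λ (e , u∈e , w∈e) → ~-trans (Eq.return (incidence⁺ u∈e)) (~-sym (Eq.return (incidence⁺ w∈e)))

    joined⇒connected′ : ∀ {a b} → Joined (vertexOf a) (vertexOf b) → Connected (incidences H) a b
    joined⇒connected′ {a} {b} p = ~-trans (toVertex a) (~-trans (joined⇒connected p) (~-sym (toVertex b)))

    representatives : List Node
    representatives = deduplicate (connected? (incidences H)) nodes

    represented : ∀ a → Any (Connected (incidences H) a) representatives
    represented a = Any.deduplicate⁺ (connected? (incidences H)) (λ p q → ~-trans q (~-sym p))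
      (lose (∈-nodes a) ε)

    -- The representatives are pairwise disconnected, so they cannot share a label. The labels are
    -- the vertices themselves in `κ≤v` and representative nodes of a second hypergraph in `κ-≤`.
    κ≤length : ∀ {Y : Set} {ys : List Y} (Rel : Fin (v H) → Y → Set) →
               (∀ u → Any (Rel u) ys) →
               (∀ {u w y} → Rel u y → Rel w y → Joined u w) →
               κ H ≤ length ys
    κ≤length Rel total coherent = length-≤ ~-sym (Rel ∘ vertexOf)
      (deduplicate-! nodeSetoid nodes) (λ {a} _ → total (vertexOf a))
      (λ p q → joined⇒connected′ (coherent p q))

    κ≤v : κ H ≤ v H
    κ≤v = subst (κ H ≤_) (length-tabulate id)
      (κ≤length _≡_ ∈-allFin λ { refl refl → ε })

    v≤κ : (∀ {u w} → Joined u w → u ≡ w) → v H ≤ κ H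
    v≤κ trivial = subst (_≤ κ H) (length-tabulate id)
      (length-≤ sym (Connected (incidences H) ∘ inj₁) (allFin⁺ (v H)) (λ {u} _ → represented (inj₁ u))
        λ p q → trivial (connected⇒joined (~-trans p (~-sym q))))

  -- Comparing component counts of two hypergraphs

  -- Reflecting `Joined` keeps distinct components distinct. A relation is allowed in place of a map
  -- so that `collapse` can be used in both directions, as a function and as its converse.
  κ-≤ : ∀ {m n} (H : Hypergraph m) (G : Hypergraph n) (Rel : Fin (v H) → Fin (v G) → Set) →
        (∀ u → ∃ (Rel u)) →
        (∀ {u w u′ w′} → Rel u u′ → Rel w w′ → Joined G u′ w′ → Joined H u w) →
        κ H ≤ κ G
  κ-≤ H G Rel total reflects = κ≤length H
    (λ u a → ∃ λ u′ → Rel u u′ × Connected (incidences G) (inj₁ u′) a)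
    (λ u → let u′ , r = total u in Any.map (λ p → u′ , r , p) (represented G (inj₁ u′)))
    (λ { (_ , r , p) (_ , s , q) → reflects r s
       (connected⇒joined G (Eq.transitive _ p (Eq.symmetric _ q))) })
    where open Multigraph (≡-dec (Fin._≟_ {v G}) Fin._≟_) using (Connected)

  -- H, H ↾ A and H ↾ A ↾ C are definitionally relabellings of H (by id, elements A
  -- and elements A ∘ elements C), so one comparison of κ covers all of them.
  relabel : ∀ {m n} → Hypergraph m → (Fin n → Fin m) → Hypergraph n
  relabel H f = record
    { v      = v H
    ; edge   = edge H ∘ f
    ; size>1 = size>1 H ∘ f
    }

  infix 4 _⊑_

  -- Inclusion of ranges. Adjacency asks only whether some hyperedge contains both vertices, so `κ`
  -- of a relabelling sees neither the order nor the repetitions of hyperedges.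
  _⊑_ : ∀ {l m n} → (Fin l → Fin n) → (Fin m → Fin n) → Set
  f ⊑ g = ∀ i → ∃ λ j → f i ≡ g j

  module _ {m : ℕ} (H : Hypergraph m) where

    κ-antitone : ∀ {l n} {f : Fin l → Fin m} {g : Fin n → Fin m} →
                 f ⊑ g → κ (relabel H g) ≤ κ (relabel H f)
    κ-antitone {f = f} {g} f⊑g = κ-≤ (relabel H g) (relabel H f) _≡_ (λ u → u , refl)
      λ { refl refl → Eq.map λ (i , u∈ , w∈) → let j , fi≡gj = f⊑g i in
        j , subst (λ e → _ ∈ edge H e) fi≡gj u∈ , subst (λ e → _ ∈ edge H e) fi≡gj w∈ }

    κ-cong : ∀ {l n} {f : Fin l → Fin m} {g : Fin n → Fin m} →
             f ⊑ g → g ⊑ f → κ (relabel H f) ≡ κ (relabel H g)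
    κ-cong f⊑g g⊑f = ≤-antisym (κ-antitone g⊑f) (κ-antitone f⊑g)

    κ-↾ : (A : Subset m) → κ H ≤ κ (H ↾ A)
    κ-↾ A = κ-antitone {g = id} λ i → elements A i , refl

  -- Contraction of one hyperedge

  module _ {n : ℕ} (f : List (Fin n)) where
    open DecMembership (Fin._≟_ {n}) using (_∈?_; _∉?_)

    collapse-∈ : ∀ {u} → u ∈ f → collapse f u ≡ zero
    collapse-∈ {u} u∈f with u ∈? f
    ... | yes _  = refl
    ... | no u∉f = ⊥-elim (u∉f u∈f)

    collapse-≡ : ∀ {u w} → collapse f u ≡ collapse f w → (u ∈ f × w ∈ f) ⊎ u ≡ w
    collapse-≡ {u} {w} eq with u ∈? f | w ∈? f
    collapse-≡ eq | yes u∈f | yes w∈f = inj₁ (u∈f , w∈f)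
    collapse-≡ () | yes _   | no _
    collapse-≡ () | no _    | yes _
    collapse-≡ eq | no u∉f  | no w∉f  = inj₂ (trans
      (Any.lookup-index (∈-filter⁺ (_∉? f) (∈-allFin _) u∉f))
      (trans (cong (lookup (untouched f)) (Fin.suc-injective eq))
             (sym (Any.lookup-index (∈-filter⁺ (_∉? f) (∈-allFin _) w∉f)))))

    collapse-suc : ∀ i → collapse f (lookup (untouched f) i) ≡ suc i
    collapse-suc i with lookup (untouched f) i ∈? f
    ... | yes u∈f = ⊥-elim (proj₂ (∈-filter⁻ (_∉? f) {xs = allFin n} (∈-lookup i)) u∈f)
    ... | no  u∉f = cong suc (sym (lookup-injective {Y = Fin n} sym (filter⁺ (_∉? f) (allFin⁺ n)) i _
                      (Any.lookup-index (∈-filter⁺ (_∉? f) (∈-allFin _) u∉f))))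

    n≤untouched+f : n ≤ length (untouched f) + length f
    n≤untouched+f = subst₂ _≤_ (length-tabulate id) (length-++ (untouched f))
      (length-≤ sym {ys = untouched f ++ f} _≡_ (allFin⁺ n) (λ {u} _ → covered u) (λ { refl refl → refl }))
      where
      covered : ∀ u → u ∈ untouched f ++ f
      covered u with u ∈? f
      ... | yes u∈f = ∈-++⁺ʳ (untouched f) u∈f
      ... | no  u∉f = ∈-++⁺ˡ (∈-filter⁺ (_∉? f) (∈-allFin u) u∉f)

  module _ {m : ℕ} (H : Hypergraph (suc m)) (e : Fin (suc m)) where

    private
      c = collapse (edge H e)

      section : ∀ x → ∃ λ u → c u ≡ x
      section zero    = proj₁ (member H e) , collapse-∈ (edge H e) (proj₂ (member H e))
      section (suc i) = lookup (untouched (edge H e)) i , collapse-suc (edge H e) i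

    -- On the right `e` stays among the hyperedges: it joins exactly those vertices that `collapse`
    -- identifies. Walks are pushed along `c`, where a step through `e` becomes stationary. They are
    -- lifted through `section`, and two preimages of one vertex are equal or joined by `e`. The map
    -- `f` is arbitrary so that both `elements B` and `id` are covered.
    κ-contract : ∀ {n} (f : Fin n → Fin m) →
                 κ (relabel (contract H e) f) ≡ κ (relabel H (e Func.∷ punchIn e ∘ f))
    κ-contract {n} f = ≤-antisym
      (κ-≤ G′ G (λ x u → c u ≡ x) section λ { refl refl → Eq.gfold (Eq.isEquivalence _) c pushed })
      (κ-≤ G G′ (λ u x → c u ≡ x) (λ u → c u , refl) λ { {u} {w} refl refl p →
        trans′ (fibre (sym (proj₂ (section (c u)))))
          (trans′ (Eq.gfold (Eq.isEquivalence _) (proj₁ ∘ section) lifted p)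
                  (fibre (proj₂ (section (c w))))) })
      where
      G = relabel H (e Func.∷ punchIn e ∘ f)
      G′ = relabel (contract H e) f
      trans′ : ∀ {u w z} → Joined G u w → Joined G w z → Joined G u z
      trans′ = Eq.transitive _

      pushed : ∀ {u w} → Adjacent G u w → Joined G′ (c u) (c w)
      pushed (zero  , u∈ , w∈) = subst₂ (Joined G′)
        (sym (collapse-∈ (edge H e) u∈)) (sym (collapse-∈ (edge H e) w∈)) ε
      pushed (suc i , u∈ , w∈) = Eq.return (i , ∈-map⁺ c u∈ , ∈-map⁺ c w∈)

      fibre : ∀ {u w} → c u ≡ c w → Joined G u w
      fibre cu≡cw with collapse-≡ (edge H e) cu≡cw
      ... | inj₁ (u∈ , w∈) = Eq.return (zero , u∈ , w∈)
      ... | inj₂ refl      = ε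

      lifted : ∀ {x y} → Adjacent G′ x y → Joined G (proj₁ (section x)) (proj₁ (section y))
      lifted (i , x∈ , y∈) with ∈-map⁻ c x∈ | ∈-map⁻ c y∈
      ... | p , p∈ , refl | q , q∈ , refl = trans′ (fibre (proj₂ (section (c p))))
        (trans′ (Eq.return (suc i , p∈ , q∈)) (fibre (sym (proj₂ (section (c q))))))

  -- Sets of hyperedges and their numberings

  elements-∈ : ∀ {m} (A : Subset m) i → elements A i Subset.∈ A
  elements-∈ (outside ∷ A) i       = there (elements-∈ A i)
  elements-∈ (inside  ∷ A) zero    = here
  elements-∈ (inside  ∷ A) (suc i) = there (elements-∈ A i)

  ∈-elements : ∀ {m} {A : Subset m} {e} → e Subset.∈ A → ∃ λ i → e ≡ elements A i
  ∈-elements {A = inside  ∷ A} here       = zero , refl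
  ∈-elements {A = outside ∷ A} (there e∈) = let i , eq = ∈-elements e∈ in i , cong suc eq
  ∈-elements {A = inside  ∷ A} (there e∈) = let i , eq = ∈-elements e∈ in suc i , cong suc eq

  module _ {m : ℕ} (B : Subset m) (e : Fin (suc m)) where

    elements-insertAt⁺ : (e Func.∷ punchIn e ∘ elements B) ⊑ elements (insertAt B e inside)
    elements-insertAt⁺ zero    = ∈-elements (lookup⇒[]= e _ (insertAt-lookup B e inside))
    elements-insertAt⁺ (suc i) = ∈-elements (lookup⇒[]= _ _
      (trans (insertAt-punchIn B e inside (elements B i)) ([]=⇒lookup (elements-∈ B i))))

    elements-insertAt⁻ : elements (insertAt B e inside) ⊑ (e Func.∷ punchIn e ∘ elements B)
    elements-insertAt⁻ i with e Fin.≟ elements (insertAt B e inside) i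
    ... | yes e≡a = zero , sym e≡a
    ... | no  e≢a = suc (proj₁ found) ,
      trans (sym (Fin.punchIn-punchOut e≢a)) (cong (punchIn e) (proj₂ found))
      where
      found : ∃ λ j → punchOut e≢a ≡ elements B j
      found = ∈-elements (lookup⇒[]= _ _ (trans (sym (insertAt-punchIn B e inside (punchOut e≢a)))
        (trans (cong (Vec.lookup (insertAt B e inside)) (Fin.punchIn-punchOut e≢a))
               ([]=⇒lookup (elements-∈ (insertAt B e inside) i)))))

  κ-contract-↾ : ∀ {m} (H : Hypergraph (suc m)) e (B : Subset m) →
                 κ (contract H e ↾ B) ≡ κ (H ↾ insertAt B e inside)
  κ-contract-↾ H e B = trans (κ-contract H e (elements B))
    (κ-cong H (elements-insertAt⁺ B e) (elements-insertAt⁻ B e))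

  κ-contract-id : ∀ {m} (H : Hypergraph (suc m)) e → κ (contract H e) ≡ κ H
  κ-contract-id H e = trans (κ-contract H e id) (κ-cong H {g = id} (λ i → _ , refl) surjective)
    where
    surjective : id ⊑ (e Func.∷ punchIn e)
    surjective i with e Fin.≟ i
    ... | yes refl = zero , refl
    ... | no  e≢i  = suc (punchOut e≢i) , sym (Fin.punchIn-punchOut e≢i)

  removeAt-∈ : ∀ {m} {A : Subset (suc m)} {e} → e Subset.∈ A → insertAt (removeAt A e) e inside ≡ A
  removeAt-∈ {A = A} {e} e∈A = subst (λ s → insertAt (removeAt A e) e s ≡ A) ([]=⇒lookup e∈A) (insertAt-removeAt A e)

  ∣insertAt∣ : ∀ {m} (B : Subset m) e → ∣ insertAt B e inside ∣ ≡ suc ∣ B ∣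
  ∣insertAt∣ B             zero    = refl
  ∣insertAt∣ (outside ∷ B) (suc e) = ∣insertAt∣ B e
  ∣insertAt∣ (inside  ∷ B) (suc e) = cong suc (∣insertAt∣ B e)

  -- Iterated contraction and its invariants

  module _ {p} (P : ∀ {m} → Hypergraph m → Subset m → ∃ Hypergraph → Set p)
    (base : ∀ {m} (H : Hypergraph m) A → ¬ Nonempty A → P H A (m , H))
    (step : ∀ {m} (H : Hypergraph (suc m)) e (A : Subset m) {G} →
            P (contract H e) A G → P H (insertAt A e inside) G) where

    -- Hides the hyperedge picked by `nonempty?`: `step` is asked for every `e`, with `A` the set
    -- still to be contracted. The motive takes the pair from `contractAll` because the number of
    -- hyperedges of `H / A` is itself computed by the recursion.
    contractAll-elim : ∀ {m} (H : Hypergraph m) A → P H A (contractAll H A)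
    contractAll-elim {zero}  H [] = base H [] λ ()
    contractAll-elim {suc m} H A with nonempty? A
    ... | yes (e , e∈A) = subst (λ A′ → P H A′ (contractAll (contract H e) (removeAt A e))) (removeAt-∈ e∈A)
      (step H e (removeAt A e) (contractAll-elim (contract H e) (removeAt A e)))
    ... | no ¬nonempty  = base H A ¬nonempty

  v-/ : ∀ {m} (H : Hypergraph m) A → v (H / A) ≡ κ (H ↾ A)
  v-/ = contractAll-elim (λ H A (_ , G) → v G ≡ κ (H ↾ A))
    (λ H A empty → ≤-antisym
      (v≤κ (H ↾ A) (Eq.fold isEquivalence λ (i , _) → ⊥-elim (empty (_ , elements-∈ A i))))
      (κ≤v (H ↾ A)))
    (λ H e A ih → trans ih (κ-contract-↾ H e A))

  κ-/ : ∀ {m} (H : Hypergraph m) A → κ (H / A) ≡ κ H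
  κ-/ = contractAll-elim (λ H A (_ , G) → κ G ≡ κ H) (λ _ _ _ → refl)
    (λ H e A ih → trans ih (κ-contract-id H e))

  module _ {k : ℕ} where

    uniform-contract : ∀ {m} (H : Hypergraph (suc m)) e →
                       Uniform (suc k) H → Uniform (suc k) (contract H e)
    uniform-contract H e u i = trans (length-map _ (edge H (punchIn e i))) (u (punchIn e i))

    uniform-/ : ∀ {m} (H : Hypergraph m) A → Uniform (suc k) H → Uniform (suc k) (H / A)
    uniform-/ = contractAll-elim (λ H A (_ , G) → Uniform (suc k) H → Uniform (suc k) G)
      (λ _ _ _ u → u) (λ H e A ih u → ih (uniform-contract H e u))

    -- Combined with `v-/`, this shows that the nullity exponent does not truncate, which `sign-∸`
    -- requires. Counting vertices along the contractions replaces a rank argument in the incidence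
    -- graph.
    v≤k∣A∣+v-/ : ∀ {m} (H : Hypergraph m) A → Uniform (suc k) H → v H ≤ k * ∣ A ∣ + v (H / A)
    v≤k∣A∣+v-/ = contractAll-elim (λ H A (_ , G) → Uniform (suc k) H → v H ≤ k * ∣ A ∣ + v G)
      (λ H A _ _ → m≤n+m (v H) (k * ∣ A ∣))
      λ H e A {G} ih u → begin
        v H                                               ≤⟨ n≤untouched+f (edge H e) ⟩
        length (untouched (edge H e)) + length (edge H e) ≡⟨ cong (length (untouched (edge H e)) +_) (u e) ⟩
        -- The vertex that replaces `e` absorbs one unit of `suc k`, so a contraction loses at most
        -- `k` vertices.
        length (untouched (edge H e)) + suc k             ≡⟨ +-suc _ k ⟩
        v (contract H e) + k                              ≤⟨ +-monoˡ-≤ k (ih (uniform-contract H e u)) ⟩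
        k * ∣ A ∣ + v (proj₂ G) + k                       ≡⟨ +-comm _ k ⟩
        k + (k * ∣ A ∣ + v (proj₂ G))                     ≡⟨ +-assoc k _ _ ⟨
        k + k * ∣ A ∣ + v (proj₂ G)                       ≡⟨ cong (_+ v (proj₂ G)) (*-suc k ∣ A ∣) ⟨
        k * suc ∣ A ∣ + v (proj₂ G)                       ≡⟨ cong (λ n → k * n + v (proj₂ G)) (∣insertAt∣ A e) ⟨
        k * ∣ insertAt A e inside ∣ + v (proj₂ G)         ∎
      where open ≤-Reasoning

    v≤k∣A∣+κ : ∀ {m} (H : Hypergraph m) A → Uniform (suc k) H → v H ≤ k * ∣ A ∣ + κ (H ↾ A)
    v≤k∣A∣+κ H A u = subst (λ n → v H ≤ k * ∣ A ∣ + n) (v-/ H A) (v≤k∣A∣+v-/ H A u)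

    dˢ-uniform : ∀ {m} (H : Hypergraph m) A → Uniform (suc k) H → dˢ H A ∸ ∣ A ∣ ≡ k * ∣ A ∣
    dˢ-uniform H A u = begin
      dˢ H A ∸ ∣ A ∣                ≡⟨ cong (_∸ ∣ A ∣) (size ∣ A ∣ (elements A)) ⟩
      ∣ A ∣ * suc k ∸ ∣ A ∣         ≡⟨ cong (_∸ ∣ A ∣) (*-suc ∣ A ∣ k) ⟩
      (∣ A ∣ + ∣ A ∣ * k) ∸ ∣ A ∣   ≡⟨ m+n∸m≡n ∣ A ∣ _ ⟩
      ∣ A ∣ * k                     ≡⟨ *-comm ∣ A ∣ k ⟩
      k * ∣ A ∣                     ∎
      where
      open ≡-Reasoning
      size : ∀ n f → sum (tabulate {n = n} (d H ∘ f)) ≡ n * suc k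
      size zero    f = refl
      size (suc n) f = cong₂ _+_ (u (f zero)) (size n (f ∘ suc))

  -- Subsets of a restriction

  embed : ∀ {m} (A : Subset m) → Subset ∣ A ∣ → Subset m
  embed []            C       = []
  embed (outside ∷ A) C       = outside ∷ embed A C
  embed (inside  ∷ A) (s ∷ C) = s ∷ embed A C

  ∣embed∣ : ∀ {m} (A : Subset m) C → ∣ embed A C ∣ ≡ ∣ C ∣
  ∣embed∣ []            []            = refl
  ∣embed∣ (outside ∷ A) C             = ∣embed∣ A C
  ∣embed∣ (inside  ∷ A) (outside ∷ C) = ∣embed∣ A C
  ∣embed∣ (inside  ∷ A) (inside  ∷ C) = cong suc (∣embed∣ A C)

  elements-embed⁺ : ∀ {m} (A : Subset m) C → elements A ∘ elements C ⊑ elements (embed A C)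
  elements-embed⁺ []            []            ()
  elements-embed⁺ (outside ∷ A) C             i       = let j , eq = elements-embed⁺ A C i in j , cong suc eq
  elements-embed⁺ (inside  ∷ A) (outside ∷ C) i       = let j , eq = elements-embed⁺ A C i in j , cong suc eq
  elements-embed⁺ (inside  ∷ A) (inside  ∷ C) zero    = zero , refl
  elements-embed⁺ (inside  ∷ A) (inside  ∷ C) (suc i) = let j , eq = elements-embed⁺ A C i in suc j , cong suc eq

  elements-embed⁻ : ∀ {m} (A : Subset m) C → elements (embed A C) ⊑ elements A ∘ elements C
  elements-embed⁻ []            []            ()
  elements-embed⁻ (outside ∷ A) C             i       = let j , eq = elements-embed⁻ A C i in j , cong suc eq
  elements-embed⁻ (inside  ∷ A) (outside ∷ C) i       = let j , eq = elements-embed⁻ A C i in j , cong suc eq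
  elements-embed⁻ (inside  ∷ A) (inside  ∷ C) zero    = zero , refl
  elements-embed⁻ (inside  ∷ A) (inside  ∷ C) (suc i) = let j , eq = elements-embed⁻ A C i in suc j , cong suc eq

  κ-↾-↾ : ∀ {m} (H : Hypergraph m) A C → κ (H ↾ A ↾ C) ≡ κ (H ↾ embed A C)
  κ-↾-↾ H A C = κ-cong H (elements-embed⁺ A C) (elements-embed⁻ A C)

open Connectivity

2∣n⊎2∣1+n : ∀ n → (2 ∣ n) ⊎ (2 ∣ suc n)
2∣n⊎2∣1+n zero    = inj₁ (divides 0 ≡.refl)
2∣n⊎2∣1+n (suc n) with 2∣n⊎2∣1+n n
... | inj₁ (divides q eq) = inj₂ (divides (suc q) (≡.cong (2 ℕ.+_) eq))
... | inj₂ 2∣1+n          = inj₁ 2∣1+n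

module Convolution {a ℓ} (R : CommutativeRing a ℓ) where
  open CommutativeRing R
  open Polynomials R
  open SetoidReasoning setoid
  open Solver commutativeSemiring using (solve; _:+_; _:*_; _:=_; con)
  open Exp semiring using (^-homo-*; ^-congˡ; ^-cong; ^-assocʳ)
  open CommutativeExp commutativeSemiring using (^-distrib-*)
  open AbelianGroupProperties +-abelianGroup using (⁻¹-involutive)
  open RingProperties ring using (-1*x≈-x)

  -- Sums over intervals of the subset lattice

  ∑⊆-cong : ∀ {m} {f g : Subset m → Carrier} → (∀ A → f A ≈ g A) → ∑⊆ f ≈ ∑⊆ g
  ∑⊆-cong {zero}  f≈g = f≈g []
  ∑⊆-cong {suc m} f≈g = +-cong (∑⊆-cong (f≈g ∘ (outside ∷_))) (∑⊆-cong (f≈g ∘ (inside ∷_)))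

  ∑⊆-+ : ∀ {m} (f g : Subset m → Carrier) → ∑⊆ (λ A → f A + g A) ≈ ∑⊆ f + ∑⊆ g
  ∑⊆-+ {zero}  f g = refl
  ∑⊆-+ {suc m} f g = trans (+-cong (∑⊆-+ {m} _ _) (∑⊆-+ {m} _ _))
    (solve 4 (λ a b c d → (a :+ b) :+ (c :+ d) := (a :+ c) :+ (b :+ d)) refl _ _ _ _)

  ∑⊆-* : ∀ {m} a (f : Subset m → Carrier) → ∑⊆ (λ A → a * f A) ≈ a * ∑⊆ f
  ∑⊆-* {zero}  a f = refl
  ∑⊆-* {suc m} a f = trans (+-cong (∑⊆-* {m} a _) (∑⊆-* {m} a _)) (sym (distribˡ a _ _))

  ∑⊆-∁ : ∀ {m} (f : Subset m → Carrier) → ∑⊆ (f ∘ ∁) ≈ ∑⊆ f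
  ∑⊆-∁ {zero}  f = refl
  ∑⊆-∁ {suc m} f = trans (+-cong (∑⊆-∁ (f ∘ (inside ∷_))) (∑⊆-∁ (f ∘ (outside ∷_)))) (+-comm _ _)

  -- The counterpart over the supersets of A of ∑⊆ (f ∘ embed A).
  ∑⊇ : ∀ {m} → Subset m → (Subset m → Carrier) → Carrier
  ∑⊇ []            f = f []
  ∑⊇ (outside ∷ A) f = ∑⊇ A (f ∘ (outside ∷_)) + ∑⊇ A (f ∘ (inside ∷_))
  ∑⊇ (inside  ∷ A) f = ∑⊇ A (f ∘ (inside ∷_))

  ∑⊇-cong : ∀ {m} (A : Subset m) {f g : Subset m → Carrier} → (∀ B → f B ≈ g B) → ∑⊇ A f ≈ ∑⊇ A g
  ∑⊇-cong []            f≈g = f≈g []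
  ∑⊇-cong (outside ∷ A) f≈g = +-cong (∑⊇-cong A (f≈g ∘ (outside ∷_))) (∑⊇-cong A (f≈g ∘ (inside ∷_)))
  ∑⊇-cong (inside  ∷ A) f≈g = ∑⊇-cong A (f≈g ∘ (inside ∷_))

  ∑⊇-⊥ : ∀ {m} (f : Subset m → Carrier) → ∑⊇ Subset.⊥ f ≈ ∑⊆ f
  ∑⊇-⊥ {zero}  f = refl
  ∑⊇-⊥ {suc m} f = +-cong (∑⊇-⊥ {m} _) (∑⊇-⊥ {m} _)

  ∑⊇-insertAt : ∀ {m} (A : Subset m) e (f : Subset (suc m) → Carrier) →
                ∑⊇ A (λ B → f (insertAt B e inside)) ≈ ∑⊇ (insertAt A e inside) f
  ∑⊇-insertAt A             zero    f = refl
  ∑⊇-insertAt (outside ∷ A) (suc e) f = +-cong (∑⊇-insertAt A e _) (∑⊇-insertAt A e _)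
  ∑⊇-insertAt (inside  ∷ A) (suc e) f = ∑⊇-insertAt A e _

  -- `D` stands for `B = A ∪ D`. The weight sees `B` only through `κ` and `|B| = |D| + |A|`, so no
  -- bijection between the numberings has to be tracked. It is universally quantified because each
  -- contraction shifts the size, turning `g` into `λ n → g n ∘ suc`.
  ∑⊆-/ : ∀ {m} (H : Hypergraph m) A (g : ℕ → ℕ → Carrier) →
         ∑⊆ (λ D → g (κ (H / A ↾ D)) (∣ D ∣ ℕ.+ ∣ A ∣)) ≈ ∑⊇ A (λ B → g (κ (H ↾ B)) ∣ B ∣)
  ∑⊆-/ = contractAll-elim
    (λ H A (_ , G) → ∀ g → ∑⊆ (λ D → g (κ (G ↾ D)) (∣ D ∣ ℕ.+ ∣ A ∣)) ≈ ∑⊇ A (λ B → g (κ (H ↾ B)) ∣ B ∣))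
    base step
    where
    base : ∀ {m} (H : Hypergraph m) A → ¬ Nonempty A → ∀ g →
           ∑⊆ (λ D → g (κ (H ↾ D)) (∣ D ∣ ℕ.+ ∣ A ∣)) ≈ ∑⊇ A (λ B → g (κ (H ↾ B)) ∣ B ∣)
    base {m} H A empty g with ≡.refl ← Empty-unique {p = A} empty = trans
      (∑⊆-cong λ D → reflexive (≡.cong (g (κ (H ↾ D)))
        (≡.trans (≡.cong (∣ D ∣ ℕ.+_) (∣⊥∣≡0 m)) (ℕ.+-identityʳ ∣ D ∣))))
      (sym (∑⊇-⊥ {m} _))

    step : ∀ {m} (H : Hypergraph (suc m)) e (A : Subset m) {G : ∃ Hypergraph} →
           (∀ g → ∑⊆ (λ D → g (κ (proj₂ G ↾ D)) (∣ D ∣ ℕ.+ ∣ A ∣)) ≈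
                  ∑⊇ A (λ B → g (κ (contract H e ↾ B)) ∣ B ∣)) →
           ∀ g → ∑⊆ (λ D → g (κ (proj₂ G ↾ D)) (∣ D ∣ ℕ.+ ∣ insertAt A e inside ∣)) ≈
                 ∑⊇ (insertAt A e inside) (λ B → g (κ (H ↾ B)) ∣ B ∣)
    step H e A {_ , G} ih g = begin
      ∑⊆ (λ D → g (κ (G ↾ D)) (∣ D ∣ ℕ.+ ∣ insertAt A e inside ∣))
        ≈⟨ ∑⊆-cong (λ D → reflexive (≡.cong (g (κ (G ↾ D)))
             (≡.trans (≡.cong (∣ D ∣ ℕ.+_) (∣insertAt∣ A e)) (ℕ.+-suc ∣ D ∣ ∣ A ∣)))) ⟩
      ∑⊆ (λ D → g (κ (G ↾ D)) (suc (∣ D ∣ ℕ.+ ∣ A ∣)))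
        ≈⟨ ih (λ n → g n ∘ suc) ⟩
      ∑⊇ A (λ B → g (κ (contract H e ↾ B)) (suc ∣ B ∣))
        ≈⟨ ∑⊇-cong A (λ B → reflexive (≡.cong₂ g (κ-contract-↾ H e B) (≡.sym (∣insertAt∣ B e)))) ⟩
      ∑⊇ A (λ B → g (κ (H ↾ insertAt B e inside)) ∣ insertAt B e inside ∣)
        ≈⟨ ∑⊇-insertAt A e _ ⟩
      ∑⊇ (insertAt A e inside) (λ B → g (κ (H ↾ B)) ∣ B ∣) ∎

  sign : ℕ → Carrier
  sign n = (- 1#) ^ n

  -- Möbius inversion in the Boolean lattice: for C ⊆ B, the signs of the sets A
  -- with C ⊆ A ⊆ B cancel unless C = B.
  ∑-interval : ∀ {m} (f g : Subset m → Carrier) →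
    ∑⊆ (λ A → sign ∣ A ∣ * (∑⊆ (f ∘ embed A) * ∑⊇ A g)) ≈ ∑⊆ (λ B → sign ∣ B ∣ * (f B * g B))
  ∑-interval {zero}  f g = refl
  ∑-interval {suc m} f g = begin
    ∑⊆ (λ A → s A * (F₀ A * (G₀ A + G₁ A))) + ∑⊆ (λ A → - 1# * s A * ((F₀ A + F₁ A) * G₁ A))
      ≈⟨ ∑⊆-+ {m} _ _ ⟨
    ∑⊆ (λ A → s A * (F₀ A * (G₀ A + G₁ A)) + - 1# * s A * ((F₀ A + F₁ A) * G₁ A))
      ≈⟨ ∑⊆-cong {m} (λ A → cancel (s A) (F₀ A) (F₁ A) (G₀ A) (G₁ A)) ⟩
    ∑⊆ (λ A → s A * (F₀ A * G₀ A) + - 1# * (s A * (F₁ A * G₁ A)))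
      ≈⟨ ∑⊆-+ {m} _ _ ⟩
    ∑⊆ (λ A → s A * (F₀ A * G₀ A)) + ∑⊆ (λ A → - 1# * (s A * (F₁ A * G₁ A)))
      ≈⟨ +-cong (∑-interval f₀ g₀)
           (trans (∑⊆-* {m} _ _) (trans (*-congˡ (∑-interval f₁ g₁)) (sym (∑⊆-* {m} _ _)))) ⟩
    ∑⊆ (λ B → s B * (f₀ B * g₀ B)) + ∑⊆ (λ B → - 1# * (s B * (f₁ B * g₁ B)))
      ≈⟨ +-congˡ (∑⊆-cong {m} (λ B → *-assoc _ _ _)) ⟨
    ∑⊆ (λ B → s B * (f₀ B * g₀ B)) + ∑⊆ (λ B → - 1# * s B * (f₁ B * g₁ B)) ∎
    where
    s : Subset m → Carrier
    s A = sign ∣ A ∣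
    f₀ f₁ g₀ g₁ F₀ F₁ G₀ G₁ : Subset m → Carrier
    f₀ = f ∘ (outside ∷_)
    f₁ = f ∘ (inside ∷_)
    g₀ = g ∘ (outside ∷_)
    g₁ = g ∘ (inside ∷_)
    F₀ A = ∑⊆ (f₀ ∘ embed A)
    F₁ A = ∑⊆ (f₁ ∘ embed A)
    G₀ A = ∑⊇ A g₀
    G₁ A = ∑⊇ A g₁

    -- The product `a * d` belongs to the first hyperedge lying in `B` but not in `C`. It occurs
    -- once with that hyperedge outside `A` and once inside, with opposite signs. The semiring
    -- solver treats `- 1#` as a variable `n`, so this term is left with the factor `1 + n`.
    cancel : ∀ s a b c d →
      s * (a * (c + d)) + - 1# * s * ((a + b) * d) ≈ s * (a * c) + - 1# * (s * (b * d))
    cancel s a b c d = begin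
      s * (a * (c + d)) + - 1# * s * ((a + b) * d)
        ≈⟨ solve 6 (λ n s a b c d → s :* (a :* (c :+ d)) :+ n :* s :* ((a :+ b) :* d) :=
             (s :* (a :* c) :+ n :* (s :* (b :* d))) :+ (con 1 :+ n) :* (s :* (a :* d)))
             refl (- 1#) s a b c d ⟩
      s * (a * c) + - 1# * (s * (b * d)) + (1# + - 1#) * (s * (a * d))
        ≈⟨ +-congˡ (*-congʳ (-‿inverseʳ 1#)) ⟩
      s * (a * c) + - 1# * (s * (b * d)) + 0# * (s * (a * d))
        ≈⟨ trans (+-congˡ (zeroˡ _)) (+-identityʳ _) ⟩
      s * (a * c) + - 1# * (s * (b * d)) ∎

  -- Arithmetic of signs

  -1*-1≈1 : - 1# * - 1# ≈ 1#
  -1*-1≈1 = trans (-1*x≈-x (- 1#)) (⁻¹-involutive 1#)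

  1^n≈1 : ∀ n → 1# ^ n ≈ 1#
  1^n≈1 zero    = refl
  1^n≈1 (suc n) = trans (*-identityˡ _) (1^n≈1 n)

  sign² : ∀ n → sign n * sign n ≈ 1#
  sign² n = trans (sym (^-distrib-* (- 1#) (- 1#) n)) (trans (^-congˡ n -1*-1≈1) (1^n≈1 n))

  cancel-sign : ∀ n x → sign n * sign n * x ≈ x
  cancel-sign n x = trans (*-congʳ (sign² n)) (*-identityˡ x)

  sign-+ : ∀ m n → sign (m ℕ.+ n) ≈ sign m * sign n
  sign-+ = ^-homo-* (- 1#)

  -- Each sign is its own inverse, so a difference of exponents becomes a product of signs, provided
  -- that it does not truncate.
  sign-∸ : ∀ {m n} → n ≤ m → sign (m ∸ n) ≈ sign m * sign n
  sign-∸ {m} {n} n≤m = begin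
    sign (m ∸ n)                     ≈⟨ cancel-sign n _ ⟨
    sign n * sign n * sign (m ∸ n)   ≈⟨ solve 2 (λ a b → a :* a :* b := (b :* a) :* a) refl _ _ ⟩
    sign (m ∸ n) * sign n * sign n   ≈⟨ *-congʳ (sign-+ (m ∸ n) n) ⟨
    sign (m ∸ n ℕ.+ n) * sign n      ≡⟨ ≡.cong (λ l → sign l * sign n) (ℕ.m∸n+n≡m n≤m) ⟩
    sign m * sign n                  ∎

  sign-even : ∀ {k} → 2 ∣ k → sign k ≈ 1#
  sign-even (divides q ≡.refl) = trans (sym (^-assocʳ (- 1#) q 2))
    (trans (*-congˡ (*-identityʳ _)) (sign² q))

  sign-odd : ∀ {k} → 2 ∤ k → sign k ≈ - 1#
  sign-odd {k} 2∤k with 2∣n⊎2∣1+n k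
  ... | inj₁ 2∣k   = contradiction 2∣k 2∤k
  ... | inj₂ 2∣1+k = begin
    sign k                    ≈⟨ cancel-sign 1 _ ⟨
    sign 1 * sign 1 * sign k  ≈⟨ *-congʳ (*-cong (*-identityʳ _) (*-identityʳ _)) ⟩
    - 1# * - 1# * sign k      ≈⟨ *-assoc _ _ _ ⟩
    - 1# * sign (suc k)       ≈⟨ *-congˡ (sign-even 2∣1+k) ⟩
    - 1# * 1#                 ≈⟨ *-identityʳ _ ⟩
    - 1#                      ∎

  sign-even-* : ∀ {k} → 2 ∣ k → ∀ n → sign (k ℕ.* n) ≈ 1#
  sign-even-* {k} 2∣k n = trans (sym (^-assocʳ (- 1#) k n)) (trans (^-congˡ n (sign-even 2∣k)) (1^n≈1 n))

  sign-odd-* : ∀ {k} → 2 ∤ k → ∀ n → sign (k ℕ.* n) ≈ sign n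
  sign-odd-* {k} 2∤k n = trans (sym (^-assocʳ (- 1#) k n)) (^-congˡ n (sign-odd 2∤k))

  neg-^ : ∀ x n → (- x) ^ n ≈ sign n * x ^ n
  neg-^ x n = trans (^-congˡ n (sym (-1*x≈-x x))) (^-distrib-* (- 1#) x n)

  x+1-1≈x : ∀ x → x + 1# - 1# ≈ x
  x+1-1≈x x = trans (+-assoc x 1# (- 1#)) (trans (+-congˡ (-‿inverseʳ 1#)) (+-identityʳ x))

  -- Expansions of the factors for a uniform hypergraph

  module WithUniform {k m} (H : Hypergraph m) (uniform : Uniform (suc k) H) where

    private
      c : Subset m → ℕ
      c A = κ (H ↾ A)

    corankTerm nullityTerm : Carrier → Subset m → Carrier
    corankTerm x B = x ^ (c B ∸ κ H)
    nullityTerm y C = y ^ ((k ℕ.* ∣ C ∣ ℕ.+ c C) ∸ v H)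

    nullityTerm-↾ : ∀ y A C → y ^ ((dˢ (H ↾ A) C ∸ ∣ C ∣ ℕ.+ κ (H ↾ A ↾ C)) ∸ v H) ≡ nullityTerm y (embed A C)
    nullityTerm-↾ y A C = ≡.cong₂ (λ d c → y ^ ((d ℕ.+ c) ∸ v H))
      (≡.trans (dˢ-uniform (H ↾ A) C (uniform ∘ elements A)) (≡.cong (k ℕ.*_) (≡.sym (∣embed∣ A C))))
      (κ-↾-↾ H A C)

    c-embed : ∀ A C → c A ≤ c (embed A C)
    c-embed A C = ≡.subst (c A ≤_) (κ-↾-↾ H A C) (κ-↾ (H ↾ A) C)

    T-shifted : ∀ x y → T H (x + 1#) (y + 1#) ≈ ∑⊆ (λ B → corankTerm x B * nullityTerm y B)
    T-shifted x y = ∑⊆-cong λ B → *-cong (^-congˡ (c B ∸ κ H) (x+1-1≈x x))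
      (^-cong (x+1-1≈x y) (≡.cong (λ d → (d ℕ.+ c B) ∸ v H) (dˢ-uniform H B uniform)))

    module _ (A : Subset m) where

      private
        m/A : ℕ
        m/A = proj₁ (contractAll H A)

      -- At first argument 0 the corank base is -1, so that factor is a sign and splits. Apart from
      -- the range of summation, `A` then enters only through `sign (c A)`.
      T-↾ : ∀ y → T (H ↾ A) 0# (y + 1#) ≈
                  sign (c A) * ∑⊆ ((λ C → sign (c C) * nullityTerm y C) ∘ embed A)
      T-↾ y = trans (∑⊆-cong {∣ A ∣} λ C → begin
          (0# - 1#) ^ (κ (H ↾ A ↾ C) ∸ c A) *
            (y + 1# - 1#) ^ ((dˢ (H ↾ A) C ∸ ∣ C ∣ ℕ.+ κ (H ↾ A ↾ C)) ∸ v H)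
            ≈⟨ *-cong (^-cong (+-identityˡ _) (≡.cong (_∸ c A) (κ-↾-↾ H A C)))
                      (trans (^-congˡ ((dˢ (H ↾ A) C ∸ ∣ C ∣ ℕ.+ κ (H ↾ A ↾ C)) ∸ v H) (x+1-1≈x y))
                             (reflexive (nullityTerm-↾ y A C))) ⟩
          sign (c (embed A C) ∸ c A) * nullityTerm y (embed A C)
            ≈⟨ *-congʳ (trans (sign-∸ (c-embed A C)) (*-comm _ _)) ⟩
          sign (c A) * sign (c (embed A C)) * nullityTerm y (embed A C)
            ≈⟨ *-assoc _ _ _ ⟩
          sign (c A) * (sign (c (embed A C)) * nullityTerm y (embed A C)) ∎)
        (∑⊆-* {∣ A ∣} _ _)

      -- At second argument 0 the nullity base is -1, and `v (H / A)` contributes `sign (c A)`. The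
      -- factor `sign (k ℕ.* ∣ D ∣)` is kept because it is the only one that depends on the parity
      -- of `k`.
      T-/ : ∀ x → T (H / A) (x + 1#) 0# ≈
        ∑⊆ (λ D → x ^ (κ (H / A ↾ D) ∸ κ H) * (sign (c A) * (sign (k ℕ.* ∣ D ∣) * sign (κ (H / A ↾ D)))))
      T-/ x = ∑⊆-cong {m/A} λ D → let n = κ (H / A ↾ D) in *-cong
        (^-cong (x+1-1≈x x) (≡.cong (n ∸_) (κ-/ H A)))
        (begin
          (0# - 1#) ^ ((dˢ (H / A) D ∸ ∣ D ∣ ℕ.+ n) ∸ v (H / A))
            ≈⟨ ^-cong (+-identityˡ _) (≡.cong (λ d → (d ℕ.+ n) ∸ v (H / A)) (dˢ-uniform (H / A) D uniform′)) ⟩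
          sign ((k ℕ.* ∣ D ∣ ℕ.+ n) ∸ v (H / A))
            ≈⟨ sign-∸ (v≤k∣A∣+κ (H / A) D uniform′) ⟩
          sign (k ℕ.* ∣ D ∣ ℕ.+ n) * sign (v (H / A))
            ≈⟨ *-cong (sign-+ (k ℕ.* ∣ D ∣) n) (reflexive (≡.cong sign (v-/ H A))) ⟩
          sign (k ℕ.* ∣ D ∣) * sign n * sign (c A)
            ≈⟨ *-comm _ _ ⟩
          sign (c A) * (sign (k ℕ.* ∣ D ∣) * sign n) ∎)
        where
        uniform′ : Uniform (suc k) (H / A)
        uniform′ = uniform-/ H A uniform

      -- Brings the sign into the form `|D| + |A|` that `∑⊆-/` accepts; the compensating
      -- `sign ∣ A ∣` is the one needed by `∑-interval`.
      sign-∣/∣ : ∀ (D : Subset m/A) → sign ∣ D ∣ ≈ sign ∣ A ∣ * sign (∣ D ∣ ℕ.+ ∣ A ∣)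
      sign-∣/∣ D = begin
        sign ∣ D ∣                               ≈⟨ cancel-sign ∣ A ∣ _ ⟨
        sign ∣ A ∣ * sign ∣ A ∣ * sign ∣ D ∣     ≈⟨ solve 2 (λ a d → a :* a :* d := a :* (d :* a)) refl _ _ ⟩
        sign ∣ A ∣ * (sign ∣ D ∣ * sign ∣ A ∣)   ≈⟨ *-congˡ (sign-+ ∣ D ∣ ∣ A ∣) ⟨
        sign ∣ A ∣ * sign (∣ D ∣ ℕ.+ ∣ A ∣)      ∎

      T-/-odd : 2 ∤ k → ∀ x → T (H / A) (x + 1#) 0# ≈
        sign (c A) * sign ∣ A ∣ * ∑⊇ A (λ B → corankTerm x B * (sign (c B) * sign ∣ B ∣))
      T-/-odd 2∤k x = begin
        T (H / A) (x + 1#) 0#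
          ≈⟨ T-/ x ⟩
        ∑⊆ (λ D → x ^ (κ (H / A ↾ D) ∸ κ H) * (sign (c A) * (sign (k ℕ.* ∣ D ∣) * sign (κ (H / A ↾ D)))))
          ≈⟨ ∑⊆-cong {m/A} (λ D → trans
               (*-congˡ (*-congˡ (*-congʳ (trans (sign-odd-* 2∤k ∣ D ∣) (sign-∣/∣ D)))))
               (solve 5 (λ x a s d n → x :* (a :* ((s :* d) :* n)) := (a :* s) :* (x :* (n :* d)))
                 refl _ _ _ _ _)) ⟩
        ∑⊆ (λ D → sign (c A) * sign ∣ A ∣ *
                  (x ^ (κ (H / A ↾ D) ∸ κ H) * (sign (κ (H / A ↾ D)) * sign (∣ D ∣ ℕ.+ ∣ A ∣))))
          ≈⟨ ∑⊆-* {m/A} _ _ ⟩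
        sign (c A) * sign ∣ A ∣ *
          ∑⊆ (λ D → x ^ (κ (H / A ↾ D) ∸ κ H) * (sign (κ (H / A ↾ D)) * sign (∣ D ∣ ℕ.+ ∣ A ∣)))
          ≈⟨ *-congˡ (∑⊆-/ H A (λ n d → x ^ (n ∸ κ H) * (sign n * sign d))) ⟩
        sign (c A) * sign ∣ A ∣ * ∑⊇ A (λ B → corankTerm x B * (sign (c B) * sign ∣ B ∣)) ∎

      T-/-even : 2 ∣ k → ∀ x → T (H / A) (x + 1#) 0# ≈
        sign (c A) * ∑⊇ A (λ B → corankTerm x B * sign (c B))
      T-/-even 2∣k x = begin
        T (H / A) (x + 1#) 0#
          ≈⟨ T-/ x ⟩
        ∑⊆ (λ D → x ^ (κ (H / A ↾ D) ∸ κ H) * (sign (c A) * (sign (k ℕ.* ∣ D ∣) * sign (κ (H / A ↾ D)))))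
          ≈⟨ ∑⊆-cong {m/A} (λ D → trans
               (*-congˡ (*-congˡ (trans (*-congʳ (sign-even-* 2∣k ∣ D ∣)) (*-identityˡ _))))
               (solve 3 (λ x a n → x :* (a :* n) := a :* (x :* n)) refl _ _ _)) ⟩
        ∑⊆ (λ D → sign (c A) * (x ^ (κ (H / A ↾ D) ∸ κ H) * sign (κ (H / A ↾ D))))
          ≈⟨ ∑⊆-* {m/A} _ _ ⟩
        sign (c A) * ∑⊆ (λ D → x ^ (κ (H / A ↾ D) ∸ κ H) * sign (κ (H / A ↾ D)))
          ≈⟨ *-congˡ (∑⊆-/ H A (λ n _ → x ^ (n ∸ κ H) * sign n)) ⟩
        sign (c A) * ∑⊇ A (λ B → corankTerm x B * sign (c B)) ∎

      χ-/ : ∀ x → χ (H / A) (- x) ≈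
        sign ∣ A ∣ * sign (κ H) * ∑⊇ A (λ B → sign ∣ B ∣ * (sign (c B) * corankTerm x B))
      χ-/ x = begin
        χ (H / A) (- x)
          ≈⟨ ∑⊆-cong {m/A} (λ D → let n = κ (H / A ↾ D) in begin
               sign ∣ D ∣ * (- x) ^ (n ∸ κ (H / A))
                 ≡⟨ ≡.cong (λ l → sign ∣ D ∣ * (- x) ^ (n ∸ l)) (κ-/ H A) ⟩
               sign ∣ D ∣ * (- x) ^ (n ∸ κ H)
                 ≈⟨ *-cong (sign-∣/∣ D) (trans (neg-^ x (n ∸ κ H)) (*-congʳ (sign-∸
                      (≡.subst (_≤ n) (κ-/ H A) (κ-↾ (H / A) D))))) ⟩
               sign ∣ A ∣ * sign (∣ D ∣ ℕ.+ ∣ A ∣) * (sign n * sign (κ H) * x ^ (n ∸ κ H))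
                 ≈⟨ solve 5 (λ a d n h x → a :* d :* (n :* h :* x) := a :* h :* (d :* (n :* x)))
                      refl _ _ _ _ _ ⟩
               sign ∣ A ∣ * sign (κ H) * (sign (∣ D ∣ ℕ.+ ∣ A ∣) * (sign n * x ^ (n ∸ κ H))) ∎) ⟩
        ∑⊆ (λ D → sign ∣ A ∣ * sign (κ H) * (sign (∣ D ∣ ℕ.+ ∣ A ∣) *
                    (sign (κ (H / A ↾ D)) * x ^ (κ (H / A ↾ D) ∸ κ H))))
          ≈⟨ ∑⊆-* {m/A} _ _ ⟩
        sign ∣ A ∣ * sign (κ H) * ∑⊆ (λ D → sign (∣ D ∣ ℕ.+ ∣ A ∣) *
                    (sign (κ (H / A ↾ D)) * x ^ (κ (H / A ↾ D) ∸ κ H)))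
          ≈⟨ *-congˡ (∑⊆-/ H A (λ n d → sign d * (sign n * x ^ (n ∸ κ H)))) ⟩
        sign ∣ A ∣ * sign (κ H) * ∑⊇ A (λ B → sign ∣ B ∣ * (sign (c B) * corankTerm x B)) ∎

      -- With `C` the complement of `B` inside `A`, `(-1)^|B|` splits into `sign ∣ A ∣` and
      -- `sign ∣ C ∣`. The negated argument supplies `sign (c C)` and `sign (v H)`, while its `k|C|`
      -- part is trivial for even `k`.
      χ*-↾ : 2 ∣ k → ∀ y → χ* k (H ↾ A) (- y) ≈
        sign ∣ A ∣ * sign (v H) * ∑⊆ ((λ C → sign ∣ C ∣ * (sign (c C) * nullityTerm y C)) ∘ embed A)
      χ*-↾ 2∣k y = begin
        χ* k (H ↾ A) (- y)
          ≈⟨ ∑⊆-cong {∣ A ∣} (λ B → term (∁ B) B (∣∁p∣≡n∸∣p∣ B) (∣p∣≤n B)) ⟩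
        ∑⊆ (h ∘ ∁)
          ≈⟨ ∑⊆-∁ h ⟩
        ∑⊆ h
          ≈⟨ ∑⊆-* {∣ A ∣} _ _ ⟩
        sign ∣ A ∣ * sign (v H) * ∑⊆ ((λ C → sign ∣ C ∣ * (sign (c C) * nullityTerm y C)) ∘ embed A) ∎
        where
        h : Subset ∣ A ∣ → Carrier
        h C = sign ∣ A ∣ * sign (v H) *
              (sign ∣ embed A C ∣ * (sign (c (embed A C)) * nullityTerm y (embed A C)))

        -- Only the size of the complement matters here, so `C` is a variable constrained by a size
        -- equation.
        term : ∀ C (B : Subset ∣ A ∣) → ∣ C ∣ ≡ ∣ A ∣ ∸ ∣ B ∣ → ∣ B ∣ ≤ ∣ A ∣ →
          sign ∣ B ∣ * (- y) ^ ((k ℕ.* (∣ A ∣ ∸ ∣ B ∣) ℕ.+ κ (H ↾ A ↾ C)) ∸ v H) ≈ h C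
        term C B ∣C∣≡ ∣B∣≤ = begin
          sign ∣ B ∣ * (- y) ^ ((k ℕ.* (∣ A ∣ ∸ ∣ B ∣) ℕ.+ κ (H ↾ A ↾ C)) ∸ v H)
            ≡⟨ ≡.cong₂ (λ d c → sign ∣ B ∣ * (- y) ^ ((k ℕ.* d ℕ.+ c) ∸ v H)) ∣A∣∸∣B∣≡ (κ-↾-↾ H A C) ⟩
          sign ∣ B ∣ * (- y) ^ ((k ℕ.* ∣ E ∣ ℕ.+ c E) ∸ v H)
            ≈⟨ *-cong sign-∣B∣ (trans (neg-^ y ((k ℕ.* ∣ E ∣ ℕ.+ c E) ∸ v H)) (*-congʳ (begin
                 sign ((k ℕ.* ∣ E ∣ ℕ.+ c E) ∸ v H)      ≈⟨ sign-∸ (v≤k∣A∣+κ H E uniform) ⟩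
                 sign (k ℕ.* ∣ E ∣ ℕ.+ c E) * sign (v H) ≈⟨ *-congʳ (sign-+ (k ℕ.* ∣ E ∣) (c E)) ⟩
                 sign (k ℕ.* ∣ E ∣) * sign (c E) * sign (v H)
                   ≈⟨ *-congʳ (trans (*-congʳ (sign-even-* 2∣k ∣ E ∣)) (*-identityˡ _)) ⟩
                 sign (c E) * sign (v H)                 ∎))) ⟩
          sign ∣ A ∣ * sign ∣ E ∣ * (sign (c E) * sign (v H) * nullityTerm y E)
            ≈⟨ solve 5 (λ a e c h y → a :* e :* (c :* h :* y) := a :* h :* (e :* (c :* y))) refl _ _ _ _ _ ⟩
          h C ∎
          where
          E = embed A C
          ∣A∣∸∣B∣≡ : ∣ A ∣ ∸ ∣ B ∣ ≡ ∣ E ∣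
          ∣A∣∸∣B∣≡ = ≡.trans (≡.sym ∣C∣≡) (≡.sym (∣embed∣ A C))
          sign-∣B∣ : sign ∣ B ∣ ≈ sign ∣ A ∣ * sign ∣ E ∣
          sign-∣B∣ = begin
            sign ∣ B ∣                             ≈⟨ cancel-sign ∣ A ∣ _ ⟨
            sign ∣ A ∣ * sign ∣ A ∣ * sign ∣ B ∣   ≈⟨ *-assoc _ _ _ ⟩
            sign ∣ A ∣ * (sign ∣ A ∣ * sign ∣ B ∣) ≈⟨ *-congˡ (sign-∸ ∣B∣≤) ⟨
            sign ∣ A ∣ * sign (∣ A ∣ ∸ ∣ B ∣)      ≡⟨ ≡.cong (λ n → sign ∣ A ∣ * sign n) ∣A∣∸∣B∣≡ ⟩
            sign ∣ A ∣ * sign ∣ E ∣                ∎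

    -- The three convolution formulas

    -- Separates the two sign checks: `expand` says that `sign ∣ A ∣` is all that survives off the
    -- ranges of summation, `diagonal` that the signs cancel once `C = A = B`.
    convolution : ∀ x y (f g : Subset m → Carrier) {t : Subset m → Carrier} →
      (∀ A → t A ≈ sign ∣ A ∣ * (∑⊆ (f ∘ embed A) * ∑⊇ A g)) →
      (∀ B → sign ∣ B ∣ * (f B * g B) ≈ corankTerm x B * nullityTerm y B) →
      T H (x + 1#) (y + 1#) ≈ ∑⊆ t
    convolution x y f g {t} expand diagonal = begin
      T H (x + 1#) (y + 1#)                                  ≈⟨ T-shifted x y ⟩
      ∑⊆ (λ B → corankTerm x B * nullityTerm y B)            ≈⟨ ∑⊆-cong diagonal ⟨
      ∑⊆ (λ B → sign ∣ B ∣ * (f B * g B))                    ≈⟨ ∑-interval f g ⟨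
      ∑⊆ (λ A → sign ∣ A ∣ * (∑⊆ (f ∘ embed A) * ∑⊇ A g))    ≈⟨ ∑⊆-cong expand ⟨
      ∑⊆ t                                                   ∎

    convolution-odd : 2 ∤ k → ∀ x y → T H (x + 1#) (y + 1#) ≈
      ∑⊆ (λ A → T (H ↾ A) 0# (y + 1#) * T (H / A) (x + 1#) 0#)
    convolution-odd 2∤k x y = convolution x y
      (λ C → sign (c C) * nullityTerm y C)
      (λ B → corankTerm x B * (sign (c B) * sign ∣ B ∣))
      (λ A → trans (*-cong (T-↾ A y) (T-/-odd A 2∤k x)) (trans
        (solve 4 (λ s a f g → (s :* f) :* ((s :* a) :* g) := s :* s :* (a :* (f :* g))) refl _ _ _ _)
        (cancel-sign (c A) _)))
      (λ B → trans
        (solve 4 (λ b s x y → b :* ((s :* y) :* (x :* (s :* b))) := b :* b :* (s :* s :* (x :* y)))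
          refl _ _ _ _)
        (trans (cancel-sign ∣ B ∣ _) (cancel-sign (c B) _)))

    -- The prefactor is `sign (v H) * sign (c A)`; it cancels `sign (v H)` from `χ*-↾` and
    -- `sign (c A)` from `T-/-even`.
    convolution-even-χ* : 2 ∣ k → ∀ x y → T H (x + 1#) (y + 1#) ≈
      ∑⊆ (λ A → sign (v H ∸ c A) * χ* k (H ↾ A) (- y) * T (H / A) (x + 1#) 0#)
    convolution-even-χ* 2∣k x y = convolution x y
      (λ C → sign ∣ C ∣ * (sign (c C) * nullityTerm y C))
      (λ B → corankTerm x B * sign (c B))
      (λ A → trans
        (*-cong (*-cong (sign-∸ (κ≤v (H ↾ A))) (χ*-↾ A 2∣k y)) (T-/-even A 2∣k x)) (trans
        (solve 5 (λ w s a f g → (w :* s) :* ((a :* w) :* f) :* (s :* g) :=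
                                w :* w :* (s :* s :* (a :* (f :* g)))) refl _ _ _ _ _)
        (trans (cancel-sign (v H) _) (cancel-sign (c A) _))))
      (λ B → trans
        (solve 4 (λ b s x y → b :* ((b :* (s :* y)) :* (x :* s)) := b :* b :* (s :* s :* (x :* y)))
          refl _ _ _ _)
        (trans (cancel-sign ∣ B ∣ _) (cancel-sign (c B) _)))

    -- By `v-/` and `κ-/` the prefactor is `sign (c A) * sign (κ H)`; it cancels `sign (c A)` from
    -- `T-↾` and `sign (κ H)` from `χ-/`.
    convolution-even-χ : 2 ∣ k → ∀ x y → T H (x + 1#) (y + 1#) ≈
      ∑⊆ (λ A → sign (v (H / A) ∸ κ (H / A)) * T (H ↾ A) 0# (y + 1#) * χ (H / A) (- x))
    convolution-even-χ 2∣k x y = convolution x y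
      (λ C → sign (c C) * nullityTerm y C)
      (λ B → sign ∣ B ∣ * (sign (c B) * corankTerm x B))
      (λ A → trans
        (*-cong (*-cong (trans (sign-∸ (κ≤v (H / A)))
                               (reflexive (≡.cong₂ (λ m n → sign m * sign n) (v-/ H A) (κ-/ H A))))
                        (T-↾ A y))
                (χ-/ A x)) (trans
        (solve 5 (λ h s a f g → (s :* h) :* (s :* f) :* ((a :* h) :* g) :=
                                h :* h :* (s :* s :* (a :* (f :* g)))) refl _ _ _ _ _)
        (trans (cancel-sign (κ H) _) (cancel-sign (c A) _))))
      (λ B → trans
        (solve 4 (λ b s x y → b :* ((s :* y) :* (b :* (s :* x))) := b :* b :* (s :* s :* (x :* y)))
          refl _ _ _ _)
        (trans (cancel-sign ∣ B ∣ _) (cancel-sign (c B) _)))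

theorem4p10 : ∀ {c ℓ} (R : CommutativeRing c ℓ) (k : ℕ) → k ≥ 1 →
  ∀ {m} (H : Hypergraph m) → Uniform (suc k) H →
  let open CommutativeRing R
      open Polynomials R
  in ∀ (x y : Carrier) →
    (2 ∤ k →
      T H (x + 1#) (y + 1#) ≈
        ∑⊆ (λ A → T (H ↾ A) 0# (y + 1#) * T (H / A) (x + 1#) 0#))
    ×
    (2 ∣ k →
      (T H (x + 1#) (y + 1#) ≈
        ∑⊆ (λ A → ((- 1#) ^ (v H ∸ κ (H ↾ A))) *
                  χ* k (H ↾ A) (- y) * T (H / A) (x + 1#) 0#))
      ×
      (T H (x + 1#) (y + 1#) ≈
        ∑⊆ (λ A → ((- 1#) ^ (v (H / A) ∸ κ (H / A))) *
                  T (H ↾ A) 0# (y + 1#) * χ (H / A) (- x))))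
theorem4p10 R k _ H uniform x y =
  (λ 2∤k → convolution-odd 2∤k x y) ,
  (λ 2∣k → convolution-even-χ* 2∣k x y , convolution-even-χ 2∣k x y)
  where open Convolution.WithUniform R H uniform
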